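{- Let $a,b\ge 1$ and let $\rho$ be the canonical sequential form of a non-crossing partition of length $a$; if $b\ge 2$, assume further that $\rho$ starts with a single $1$ (i.e. its initial run of $1$'s has length exactly one), with no such restriction if $b=1$. Let $\tau=(\rho+1)1^b$. If $n\ge a+b-1$, then the total number of occurrences of the subword $\tau$ within all the members of $NC_n$, i.e. $\sum_{\pi\in NC_n}\mu_\tau(\pi)$, is $\binom{2r-2}{r+1}$, where $r=n-a-b+2$.
   Context: A set partition of $[n]=\{1,\dots,n\}$ with blocks $B_1,\dots,B_k$ ordered so that $\min B_1<\cdots<\min B_k$ is represented by its canonical sequential form $\pi=\pi_1\cdots\pi_n$, where $i\in B_{\pi_i}$ for each $i$; $n$ is its length. It is non-crossing if $\pi$ contains no (not necessarily consecutive) subsequence of the form $a\,b\,a\,b$ with $a<b$. $NC_n$ denotes the set of non-crossing partitions of $[n]$, identified with their canonical sequential forms. A subword pattern is a finite sequence $\tau=\tau_1\cdots\tau_k$ of positive integers whose set of distinct letters is $[\ell]$ for some $\ell$. An occurrence of $\tau$ in a sequence $\sigma_1\cdots\sigma_n$ is an index $i\in[n-k+1]$ such that the string of consecutive letters $\sigma_i\cdots\sigma_{i+k-1}$ is order-isomorphic to $\tau$ (same relative order, including equalities). $\mu_\tau(\pi)$ denotes the number of occurrences of $\tau$ in $\pi$. $\rho+1$ is the sequence obtained by adding $1$ to each entry of $\rho$, $1^b$ is the word of $b$ ones, and juxtaposition is concatenation. -}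

module Defs where

open import Data.Bool using (true)
open import Data.Fin as Fin using (Fin; toℕ; fromℕ<)
open import Data.Fin.Properties as Fin using (any?; all?)
open import Data.Fin.Subset using (Subset; _∈_)
open import Data.List
  using (List; []; _∷_; map; length; take; drop; takeWhile; filter; lookup; tabulate;
         upTo; cartesianProductWith)
open import Data.List.Membership.Propositional using () renaming (_∈_ to _∈ˡ_)
open import Data.List.Membership.Propositional.Properties as ∈ˡ using ()
open import Data.List.Properties as List using ()
open import Data.List.Relation.Binary.Sublist.DecPropositional using (_⊆?_)
open import Data.List.Relation.Binary.Sublist.Propositional as Sublist using (_⊆_)
open import Data.List.Relation.Unary.All as All using (All; [])
open import Data.List.Relation.Unary.Any using (here; there)
open import Data.List.Relation.Unary.AllPairs using ([]; _∷_)
open import Data.List.Relation.Unary.Unique.Propositional using (Unique)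
open import Data.List.Relation.Unary.Unique.Propositional.Properties as Unique using ()
open import Data.Nat
open import Data.Nat.Properties
open import Data.Product using (Σ; ∃; _×_; _,_; proj₁; proj₂)
open import Data.Vec as Vec using ()
open import Data.Vec.Properties as Vec using ()
open import Function using (_⇔_; mk⇔; Equivalence; Injective)
open import Relation.Binary.PropositionalEquality
open import Relation.Nullary using (¬_; Dec; yes; no; does)
open import Relation.Nullary.Decidable
  using (map′; _×-dec_; _→-dec_; ¬?; dec-true)

-- Positions and block indices are 0-based here; the letters of words are 1-based.
-- `least j` is min Bⱼ, so nonemptiness of the blocks is part of the data.

record SetPartition (n : ℕ) : Set where
  field
    size     : ℕ
    block    : Fin size → Subset n
    cover    : ∀ i → ∃ λ j → i ∈ block j
    disjoint : ∀ {i j j′} → i ∈ block j → i ∈ block j′ → j ≡ j′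
    least    : Fin size → Fin n
    least-∈  : ∀ j → least j ∈ block j
    least-≤  : ∀ {i j} → i ∈ block j → least j Fin.≤ i
    ordered  : ∀ {j j′} → j Fin.< j′ → least j Fin.< least j′

  letter : Fin n → ℕ
  letter i = suc (toℕ (proj₁ (cover i)))

  canonicalForm : List ℕ
  canonicalForm = tabulate letter

open SetPartition using (canonicalForm)

IsCanonicalForm : ℕ → List ℕ → Set
IsCanonicalForm n π = ∃ λ (P : SetPartition n) → canonicalForm P ≡ π

-- `_⊆_` is the (not necessarily consecutive) subsequence relation.

NonCrossing : List ℕ → Set
NonCrossing π = ∀ a b → a < b → ¬ (a ∷ b ∷ a ∷ b ∷ [] ⊆ π)

IsNC : ℕ → List ℕ → Set
IsNC n π = IsCanonicalForm n π × NonCrossing π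

OrderIsomorphic : List ℕ → List ℕ → Set
OrderIsomorphic u v = Σ (length u ≡ length v) λ eq → ∀ i j →
  (lookup u i < lookup u j ⇔ lookup v (Fin.cast eq i) < lookup v (Fin.cast eq j)) ×
  (lookup u i ≡ lookup u j ⇔ lookup v (Fin.cast eq i) ≡ lookup v (Fin.cast eq j))

private
  _⇔-dec_ : ∀ {A B : Set} → Dec A → Dec B → Dec (A ⇔ B)
  a? ⇔-dec b? = map′ (λ (f , g) → mk⇔ f g) (λ e → Equivalence.to e , Equivalence.from e)
                     ((a? →-dec b?) ×-dec (b? →-dec a?))

orderIsomorphic? : ∀ u v → Dec (OrderIsomorphic u v)
orderIsomorphic? u v with length u ≟ length v
... | no  ≢  = no λ (eq , _) → ≢ eq
... | yes eq = map′ (eq ,_) proj₂ (all? λ i → all? λ j →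
        ((_ <? _) ⇔-dec (_ <? _)) ×-dec ((_ ≟ _) ⇔-dec (_ ≟ _)))

-- A word of length n has n - k + 1 windows of length k when k ≤ n, and none
-- otherwise; hence `suc n ∸ k` rather than `suc (n ∸ k)`.

μ : List ℕ → List ℕ → ℕ
μ τ π = length (filter (λ i → orderIsomorphic? τ (take k (drop i π)))
                       (upTo (suc (length π) ∸ k)))
  where k = length τ

nonCrossing? : ∀ π → Dec (NonCrossing π)
nonCrossing? π = map′ to from
  (All.all? (λ a → All.all? (λ b → (a <? b) →-dec ¬? (_⊆?_ _≟_ (a ∷ b ∷ a ∷ b ∷ []) π)) π) π)
  where
  to : All (λ a → All (λ b → a < b → ¬ (a ∷ b ∷ a ∷ b ∷ [] ⊆ π)) π) π → NonCrossing π
  to all a b a<b s =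
    All.lookup (All.lookup all (Sublist.lookup s (here refl)))
               (Sublist.lookup s (there (here refl))) a<b s

  from : NonCrossing π → All (λ a → All (λ b → a < b → ¬ (a ∷ b ∷ a ∷ b ∷ [] ⊆ π)) π) π
  from nc = All.tabulate λ {a} _ → All.tabulate λ {b} _ → nc a b

size≤n : ∀ {n} (P : SetPartition n) → SetPartition.size P ≤ n
size≤n P = Fin.injective⇒≤ inj
  where
  open SetPartition P
  inj : Injective _≡_ _≡_ least
  inj {j} {j′} eq = disjoint (least-∈ j) (subst (_∈ block j′) (sym eq) (least-∈ j′))

private
  module Fibres {n : ℕ} (f : Fin n → ℕ) where

    Least : ℕ → Fin n → Set
    Least x i = f i ≡ x × (∀ i′ → f i′ ≡ x → i Fin.≤ i′)

    least? : ∀ x i → Dec (Least x i)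
    least? x i = (f i ≟ x) ×-dec all? λ i′ → (f i′ ≟ x) →-dec (i Fin.≤? i′)

    Labels : ℕ → Set
    Labels k =
      (∀ i → ∃ λ (j : Fin k) → f i ≡ suc (toℕ j)) ×
      (∀ (j : Fin k) → ∃ λ i → Least (suc (toℕ j)) i) ×
      (∀ (j j′ : Fin k) → j Fin.< j′ → ∀ i i′ →
         Least (suc (toℕ j)) i → Least (suc (toℕ j′)) i′ → i Fin.< i′)

    labels? : ∀ k → Dec (Labels k)
    labels? k =
      (all? λ i → any? λ j → f i ≟ suc (toℕ j)) ×-dec
      (all? λ j → any? λ i → least? (suc (toℕ j)) i) ×-dec
      (all? λ j → all? λ j′ → (j Fin.<? j′) →-dec all? λ i → all? λ i′ →
         least? _ i →-dec (least? _ i′ →-dec (i Fin.<? i′)))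

    fibre : ∀ {k} → Fin k → Subset n
    fibre j = Vec.tabulate λ i → does (f i ≟ suc (toℕ j))

    ∈-fibre⁺ : ∀ {k i} {j : Fin k} → f i ≡ suc (toℕ j) → i ∈ fibre j
    ∈-fibre⁺ {i = i} {j} eq = Vec.lookup⇒[]= i _
      (trans (Vec.lookup∘tabulate _ i) (dec-true (f i ≟ suc (toℕ j)) eq))

    ∈-fibre⁻ : ∀ {k i} {j : Fin k} → i ∈ fibre j → f i ≡ suc (toℕ j)
    ∈-fibre⁻ {i = i} {j} i∈ = witness (f i ≟ suc (toℕ j))
      (trans (sym (Vec.lookup∘tabulate _ i)) (Vec.[]=⇒lookup i∈))
      where
      witness : ∀ {A : Set} (a? : Dec A) → does a? ≡ true → A
      witness (yes a) _ = a

    toPartition : ∀ {k} → Labels k → ∃ λ (P : SetPartition n) → ∀ i → SetPartition.letter P i ≡ f i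
    toPartition {k} (cov , lst , ord) = P , λ i → sym (proj₂ (cov i))
      where
      P : SetPartition n
      P = record
        { size     = k
        ; block    = fibre
        ; cover    = λ i → proj₁ (cov i) , ∈-fibre⁺ (proj₂ (cov i))
        ; disjoint = λ p q → Fin.toℕ-injective (suc-injective (trans (sym (∈-fibre⁻ p)) (∈-fibre⁻ q)))
        ; least    = λ j → proj₁ (lst j)
        ; least-∈  = λ j → ∈-fibre⁺ (proj₁ (proj₂ (lst j)))
        ; least-≤  = λ {i} {j} p → proj₂ (proj₂ (lst j)) i (∈-fibre⁻ p)
        ; ordered  = λ {j} {j′} lt → ord j j′ lt _ _ (proj₂ (lst j)) (proj₂ (lst j′))
        }

    fromPartition : (P : SetPartition n) → (∀ i → SetPartition.letter P i ≡ f i) →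
                    Labels (SetPartition.size P)
    fromPartition P eq =
      (λ i → proj₁ (cover i) , sym (eq i)) ,
      (λ j → least j , ∈⇒≡ (least-∈ j) , λ i p → least-≤ (≡⇒∈ p)) ,
      λ j j′ lt i i′ (p , i≤) (q , i′≤) → ≤-<-trans
        (i≤ _ (∈⇒≡ (least-∈ j))) (<-≤-trans (ordered lt) (least-≤ (≡⇒∈ q)))
      where
      open SetPartition P
      ∈⇒≡ : ∀ {i j} → i ∈ block j → f i ≡ suc (toℕ j)
      ∈⇒≡ {i} p = trans (sym (eq i)) (cong (λ j → suc (toℕ j)) (disjoint (proj₂ (cover i)) p))
      ≡⇒∈ : ∀ {i j} → f i ≡ suc (toℕ j) → i ∈ block j
      ≡⇒∈ {i} p = subst (λ j → i ∈ block j)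
        (Fin.toℕ-injective (suc-injective (trans (eq i) p))) (proj₂ (cover i))

isCanonicalForm? : ∀ n π → Dec (IsCanonicalForm n π)
isCanonicalForm? n π with length π ≟ n
... | no  ≢   = no λ { (P , refl) → ≢ (List.length-tabulate (SetPartition.letter P)) }
... | yes len = map′ to from (any? λ k → Fibres.labels? f (toℕ k))
  where
  f : Fin n → ℕ
  f i = lookup π (Fin.cast (sym len) i)

  tabulate-f : ∀ {m} (eq : m ≡ length π) → tabulate (λ i → lookup π (Fin.cast eq i)) ≡ π
  tabulate-f refl = trans
    (List.tabulate-cong λ i → cong (lookup π) (Fin.cast-is-id refl i)) (List.tabulate-lookup π)

  to : (∃ λ (k : Fin (suc n)) → Fibres.Labels f (toℕ k)) → IsCanonicalForm n π
  to (_ , ls) = let P , eq = Fibres.toPartition f ls in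
    P , trans (List.tabulate-cong eq) (tabulate-f (sym len))

  from : IsCanonicalForm n π → ∃ λ (k : Fin (suc n)) → Fibres.Labels f (toℕ k)
  from (P , refl) = fromℕ< (s≤s (size≤n P)) ,
    subst (Fibres.Labels f) (sym (Fin.toℕ-fromℕ< _))
      (Fibres.fromPartition f P λ i → sym (List.lookup-tabulate (SetPartition.letter P) i))

isNC? : ∀ n π → Dec (IsNC n π)
isNC? n π = isCanonicalForm? n π ×-dec nonCrossing? π

words : ℕ → ℕ → List (List ℕ)
words zero    m = [] ∷ []
words (suc l) m = cartesianProductWith _∷_ (map suc (upTo m)) (words l m)

-- A partition of [n] has at most n blocks, so letters beyond n need not be
-- searched; see ∈-NC⇔.

NC : ℕ → List (List ℕ)
NC n = filter (isNC? n) (words n n)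

private
  words⁺ : ∀ {m} l (f : Fin l → ℕ) → (∀ i → f i ∈ˡ map suc (upTo m)) → tabulate f ∈ˡ words l m
  words⁺ zero    f f∈ = here refl
  words⁺ (suc l) f f∈ = ∈ˡ.∈-cartesianProductWith⁺ _∷_ (f∈ Fin.zero)
                          (words⁺ l (λ i → f (Fin.suc i)) (λ i → f∈ (Fin.suc i)))

  words-unique : ∀ l m → Unique (words l m)
  words-unique zero    m = [] ∷ []
  words-unique (suc l) m = Unique.cartesianProductWith⁺ _∷_ List.∷-injective
    (Unique.map⁺ suc-injective (Unique.upTo⁺ m)) (words-unique l m)

∈-NC⇔ : ∀ {n π} → π ∈ˡ NC n ⇔ IsNC n π
∈-NC⇔ {n} {π} = mk⇔
  (λ p → proj₂ (∈ˡ.∈-filter⁻ (isNC? n) {xs = words n n} p))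
  (λ p → ∈ˡ.∈-filter⁺ (isNC? n) (∈-words (proj₁ p)) p)
  where
  ∈-words : IsCanonicalForm n π → π ∈ˡ words n n
  ∈-words (P , refl) = words⁺ n (SetPartition.letter P) λ i →
    ∈ˡ.∈-map⁺ suc (∈ˡ.∈-upTo⁺ (<-≤-trans (Fin.toℕ<n (proj₁ (SetPartition.cover P i))) (size≤n P)))

NC-unique : ∀ n → Unique (NC n)
NC-unique n = Unique.filter⁺ (isNC? n) (words-unique n n)

StartsWithSingle1 : List ℕ → Set
StartsWithSingle1 ρ = length (takeWhile (_≟ 1) ρ) ≡ 1

{-# OPTIONS --safe #-}
module Submission where

-- In left-to-right order, a non-crossing word is read with the stack of its letters that may still
-- recur: the next letter is either new (push) or on the stack (pop down to it), so only the height
-- of the stack matters for counting. Let y be the first letter of an occurrence of τ = (ρ + 1) 1ᵇ.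
-- Letters above y in the window cannot have occurred before it, so the copy of ρ is determined by y,
-- and it leaves the stack below y intact; the occurrence is then completed by b copies of any x below
-- y on the stack. Hence occurrences of τ in words of length n satisfy the same recurrence as
-- descents y x in words of length r, which is solved by binomial coefficients.

open import Defs
open import Data.Bool using (true; false; if_then_else_)
open import Data.Fin as Fin using (Fin; toℕ; fromℕ<)
import Data.Fin.Properties as Fin
import Data.Fin.Subset as Subset
open import Data.List
  using (List; []; _∷_; _++_; map; length; lookup; tabulate; replicate; take; drop; filter;
         applyUpTo; upTo; concatMap)
open import Data.List.Membership.Propositional using (_∈_)
open import Data.List.Membership.Propositional.Properties
  using (∈-++⁺ʳ; ∈-map⁺; ∈-map⁻; ∈-concatMap⁺; ∈-concatMap⁻)
open import Data.List.Membership.Propositional.Properties.WithK using (unique∧set⇒bag)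
open import Data.List.Properties
  using (tabulate-lookup; tabulate-cong; length-tabulate; map-∘; map-++; map-cong-local; map-replicate;
         map-upTo; length-map; length-++; length-replicate; length-take; ++-cancelˡ; ∷-injective;
         ∷-injectiveˡ; ∷-injectiveʳ)
open import Data.List.Relation.Binary.BagAndSetEquality using (∼bag⇒↭)
open import Data.List.Relation.Binary.Disjoint.Propositional using (Disjoint)
open import Data.List.Relation.Binary.Permutation.Propositional using (_↭_)
open import Data.List.Relation.Binary.Permutation.Propositional.Properties using (map⁺)
open import Data.List.Relation.Binary.Pointwise as Pointwise using (Pointwise; []; _∷_)
open import Data.List.Relation.Binary.Prefix.Heterogeneous using (Prefix; []; _∷_)
open import Data.List.Relation.Binary.Prefix.Heterogeneous.Properties using (prefix?)
open import Data.List.Relation.Binary.Sublist.Propositional as Sublist using (_⊆_; _∷_; _∷ʳ_)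
open import Data.List.Relation.Unary.All as All using (All; []; _∷_)
import Data.List.Relation.Unary.All.Properties as All
open import Data.List.Relation.Unary.AllPairs as AllPairs using (AllPairs; []; _∷_)
import Data.List.Relation.Unary.AllPairs.Properties as AllPairs
open import Data.List.Relation.Unary.Any as Any using (Any; here; there)
open import Data.List.Relation.Unary.Unique.Propositional using (Unique)
import Data.List.Relation.Unary.Unique.Propositional.Properties as Unique
open import Data.Nat
open import Data.Nat.Combinatorics using (_C_; nCk+nC[k+1]≡[n+1]C[k+1]; nCk≡nC[n∸k]; k>n⇒nCk≡0; nC1≡n)
open import Data.Nat.ListAction using (sum)
open import Data.Nat.ListAction.Properties using (sum-++; sum-↭)
open import Data.Nat.Properties
open import Data.Nat.Tactic.RingSolver using (solve-∀)
open import Algebra.Properties.CommutativeSemigroup +-commutativeSemigroup using (interchange)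
open import Data.Product using (∃; ∃₂; _×_; _,_; proj₁; proj₂)
open import Data.Sum using (_⊎_; inj₁; inj₂)
import Data.Vec as Vec
import Data.Vec.Properties as Vec
open import Function using (_∘_; _⇔_; mk⇔; Equivalence)
open import Relation.Binary.Definitions using (tri<; tri≈; tri>)
open import Relation.Binary.PropositionalEquality
open import Relation.Nullary using (¬_; Dec; yes; no; does; contradiction)
open import Relation.Nullary.Decidable using (dec-true; dec-false)
open import Relation.Unary using (Decidable)

-- Ballot numbers and the descent recurrence

below : (ℕ → ℕ) → ℕ → ℕ
below F zero    = 0
below F (suc h) = F h + below F h

-- From a stack of height h, `runs l h` counts the continuations of length l, and `descents e h` the
-- occurrences of τ in the continuations of length |τ| - 1 + e.
runs : ℕ → ℕ → ℕ
runs zero    h = 1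
runs (suc l) h = below (λ j → runs l (suc j)) (suc h)

descents : ℕ → ℕ → ℕ
descents zero    h = 0
descents (suc e) h = below (λ j → below (λ i → runs e (suc i)) j + descents e (suc j)) (suc h)

pascal : ∀ n k → suc n C suc k ≡ n C k + n C suc k
pascal n k = sym (nCk+nC[k+1]≡[n+1]C[k+1] n k)

C-absorb : ∀ n k → suc k * (suc n C suc k) ≡ suc n * (n C k)
C-absorb n zero = trans (+-identityʳ _) (trans (nC1≡n (suc n)) (sym (*-identityʳ (suc n))))
C-absorb zero (suc k) rewrite k>n⇒nCk≡0 {0} {suc k} z<s | k>n⇒nCk≡0 {1} {suc (suc k)} (s<s z<s) = *-zeroʳ k
C-absorb (suc n) (suc k) = begin
  suc (suc k) * (suc (suc n) C suc (suc k))
    ≡⟨ cong (suc (suc k) *_) (pascal (suc n) (suc k)) ⟩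
  suc (suc k) * (suc n C suc k + suc n C suc (suc k))
    ≡⟨ *-distribˡ-+ (suc (suc k)) (suc n C suc k) _ ⟩
  suc (suc k) * (suc n C suc k) + suc (suc k) * (suc n C suc (suc k))
    ≡⟨ cong₂ (λ x y → (suc n C suc k + x) + y) (C-absorb n k) (C-absorb n (suc k)) ⟩
  (suc n C suc k + suc n * (n C k)) + suc n * (n C suc k)
    ≡⟨ regroup (suc n C suc k) (suc n) (n C k) (n C suc k) ⟩
  suc n C suc k + suc n * (n C k + n C suc k)
    ≡⟨ cong (λ x → suc n C suc k + suc n * x) (pascal n k) ⟨
  suc (suc n) * (suc n C suc k) ∎
  where
  open ≡-Reasoning
  regroup : ∀ x m y z → (x + m * y) + m * z ≡ x + m * (y + z)
  regroup = solve-∀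

-- These are the ballot numbers; the binomial that reflection subtracts stands on the left. Its
-- lower index is the complement of `e - 1`, so `e = 0` is no exception. Splitting off the top
-- summand of `below` gives `runs e (suc (suc h)) + runs (suc e) h`, which matches Pascal's rule.
runs-closed : ∀ e h → runs e h + (e + (e + h)) C suc (e + h) ≡ (e + (e + h)) C e
runs-closed zero h = cong suc (k>n⇒nCk≡0 (n<1+n h))
runs-closed (suc e) zero with runs-closed e 1
... | ih rewrite +-identityʳ e | +-suc e 0 | +-suc e (e + 0) | +-suc e e | +-identityʳ e | +-identityʳ (runs e 1)
  = combine (runs e 1) (pascal (suc (e + e)) (suc e)) (pascal (suc (e + e)) e) ih
  where
  combine : ∀ x {p q r s t} → s ≡ q + r → t ≡ p + q → x + r ≡ p → x + s ≡ t
  combine x {q = q} {r} refl refl refl = regroup x q r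
    where
    regroup : ∀ x q r → x + (q + r) ≡ x + r + q
    regroup = solve-∀
runs-closed (suc e) (suc h) with runs-closed e (suc (suc h)) | runs-closed (suc e) h
... | p | q rewrite +-suc e (suc h) | +-suc e h | +-suc e (suc (e + h)) | +-suc e (e + h)
  = combine (runs e (suc (suc h))) (runs (suc e) h) (pascal m k) (pascal m e) p q
  where
  m = suc (suc (e + (e + h)))
  k = suc (suc (e + h))
  combine : ∀ x y {p q r s t u} → t ≡ q + r → u ≡ p + s → x + r ≡ p → y + q ≡ s → (x + y) + t ≡ u
  combine x y {q = q} {r} refl refl refl refl = regroup x y q r
    where
    regroup : ∀ x y q r → x + y + (q + r) ≡ x + r + (y + q)
    regroup = solve-∀

C-sym : ∀ j k → (j + k) C j ≡ (j + k) C k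
C-sym j k = trans (nCk≡nC[n∸k] (m≤m+n j k)) (cong ((j + k) C_) (m+n∸m≡n j k))

-- Ratio of the central binomial to its neighbour; it settles height 0 in `descents-closed`.
C-middle : ∀ e → suc e * (suc (suc (e + e)) C suc e) ≡ suc (suc e) * (suc (suc (e + e)) C suc (suc e))
C-middle e = begin
  suc e * (suc (suc (e + e)) C suc e)             ≡⟨ C-absorb (suc (e + e)) e ⟩
  suc (suc (e + e)) * (suc (e + e) C e)           ≡⟨ cong (λ n → suc n * (n C e)) (+-suc e e) ⟨
  suc (e + suc e) * ((e + suc e) C e)             ≡⟨ cong (suc (e + suc e) *_) (C-sym e (suc e)) ⟩
  suc (e + suc e) * ((e + suc e) C suc e)         ≡⟨ cong (λ n → suc n * (n C suc e)) (+-suc e e) ⟩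
  suc (suc (e + e)) * (suc (e + e) C suc e)       ≡⟨ C-absorb (suc (e + e)) (suc e) ⟨
  suc (suc e) * (suc (suc (e + e)) C suc (suc e)) ∎
  where open ≡-Reasoning

-- The two binomials with factor e are a particular solution of the recurrence for `descents`, whose
-- source term is `runs`; the last two solve the homogeneous recurrence and fix the boundary values.
DescentsClosed : ℕ → ℕ → Set
DescentsClosed e h =
  let n = e + (e + h) in
  descents e h + e * (n C e) ≡ e * (n C suc e) + (n C suc (e + h) + n C suc (suc (e + h)))

-- At height 1 the row `2e + 1` is odd, so its two middle binomials agree and the terms with factor
-- `e` cancel. The closed form is a hypothesis here because the induction that proves it uses this
-- lemma for its case of height 0.
descents-one : ∀ e → DescentsClosed e 1 → descents e 1 ≡ suc (suc (e + e)) C suc (suc (suc e))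
descents-one e p = trans
  (+-cancelʳ-≡ (e * ((e + (e + 1)) C e)) (descents e 1) _
    (trans p (trans (+-comm _ (s + t)) (cong (λ c → s + t + e * c) central))))
  (trans (sym (pascal (e + (e + 1)) (suc (e + 1)))) (cong₂ (λ x y → suc x C suc (suc y)) n≡ (+-comm e 1)))
  where
  s = (e + (e + 1)) C suc (e + 1)
  t = (e + (e + 1)) C suc (suc (e + 1))
  n≡ : e + (e + 1) ≡ suc (e + e)
  n≡ = trans (cong (e +_) (+-comm e 1)) (+-suc e e)
  central : (e + (e + 1)) C suc e ≡ (e + (e + 1)) C e
  central = trans (cong ((e + (e + 1)) C_) (+-comm 1 e)) (sym (C-sym e (e + 1)))

-- Splitting off the top summand expresses `descents (suc e) (suc h)` through
-- `descents e (suc (suc h))`, `descents (suc e) h` and a source sum, which is by definition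
-- `runs (suc e) h`.
descents-closed : ∀ e h → DescentsClosed e h
descents-closed zero h
  rewrite k>n⇒nCk≡0 {h} {suc h} (n<1+n h) | k>n⇒nCk≡0 {h} {suc (suc h)} (m<n⇒m<1+n (n<1+n h)) = refl
descents-closed (suc e) zero
  rewrite +-identityʳ (descents e 1) | descents-one e (descents-closed e 1)
        | +-identityʳ e | +-suc e e | C-middle e
  = regroup (suc e) (suc (suc (e + e)) C suc (suc e)) (suc (suc (e + e)) C suc (suc (suc e)))
  where
  regroup : ∀ e x y → y + (x + e * x) ≡ e * x + (x + y)
  regroup = solve-∀
descents-closed (suc e) (suc h)
  with descents-closed e (suc (suc h)) | descents-closed (suc e) h | runs-closed (suc e) h | C-sym e (suc (suc (e + h)))
... | p | q | r | s
  rewrite +-suc e (suc h) | +-suc e h | +-suc e (suc (e + h)) | +-suc e (e + h)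
        | pascal (suc (suc (e + (e + h)))) e | pascal (suc (suc (e + (e + h)))) (suc e)
        | pascal (suc (suc (e + (e + h)))) (suc (suc (e + h))) | pascal (suc (suc (e + (e + h)))) (suc (suc (suc (e + h))))
  = combine e (runs (suc e) h) (descents e (suc (suc h))) (descents (suc e) h) p q r s
  where
  -- After Pascal's rule all binomials lie in row `2e + h + 2`: the lower index of `cᵢ` is `e + i`,
  -- that of `dᵢ` is `e + h + i`.
  combine : ∀ e R x y {c₀ c₁ c₂ d₂ d₃ d₄} →
    x + e * c₀ ≡ e * c₁ + (d₃ + d₄) → y + suc e * c₁ ≡ suc e * c₂ + (d₂ + d₃) →
    R + d₂ ≡ c₁ → c₀ ≡ d₂ →
    (R + x) + y + suc e * (c₀ + c₁) ≡ suc e * (c₁ + c₂) + ((d₂ + d₃) + (d₃ + d₄))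
  combine e R x y {c₀} {c₁} {c₂} {d₂} {d₃} {d₄} p q r refl = begin
    (R + x) + y + suc e * (c₀ + c₁)                                   ≡⟨ split e R x y c₀ c₁ ⟩
    (R + c₀) + (x + e * c₀) + (y + suc e * c₁)                        ≡⟨ cong₂ _+_ (cong₂ _+_ r p) q ⟩
    c₁ + (e * c₁ + (d₃ + d₄)) + (suc e * c₂ + (d₂ + d₃))              ≡⟨ join e c₁ c₂ d₂ d₃ d₄ ⟩
    suc e * (c₁ + c₂) + ((d₂ + d₃) + (d₃ + d₄))                       ∎
    where
    open ≡-Reasoning
    split : ∀ e R x y a b → (R + x) + y + suc e * (a + b) ≡ (R + a) + (x + e * a) + (y + suc e * b)
    split = solve-∀
    join : ∀ e b c d f g → b + (e * b + (f + g)) + (suc e * c + (d + f)) ≡ suc e * (b + c) + ((d + f) + (f + g))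
    join = solve-∀

descents-total : ∀ e → descents e 0 ≡ (e + e) C (suc (suc e))
descents-total zero    = sym (k>n⇒nCk≡0 {0} {2} z<s)
descents-total (suc e) = begin
  descents e 1 + 0                        ≡⟨ +-identityʳ _ ⟩
  descents e 1                            ≡⟨ descents-one e (descents-closed e 1) ⟩
  suc (suc (e + e)) C suc (suc (suc e))   ≡⟨ cong (λ n → suc n C suc (suc (suc e))) (+-suc e e) ⟨
  (suc e + suc e) C suc (suc (suc e))     ∎
  where open ≡-Reasoning

-- Non-crossing words and stacks

private
  variable
    a b m m′ x y : ℕ
    s s′ t w : List ℕ

-- A pair `(x , t)` is a possible return to `x`: everything above `x` is discarded, and `x` stays on
-- top of `t`.
pops : List ℕ → List (ℕ × List ℕ)
pops []      = []
pops (x ∷ s) = (x , s) ∷ pops s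

-- Run m s w m′ s′: with largest letter m so far and stack s of the letters that may still recur
-- (latest first), the word w can be read and leaves the state m′, s′.
data Run : ℕ → List ℕ → List ℕ → ℕ → List ℕ → Set where
  []  : Run m s [] m s
  new : Run (suc m) (suc m ∷ s) w m′ s′ → Run m s (suc m ∷ w) m′ s′
  old : (x , t) ∈ pops s → Run m (x ∷ t) w m′ s′ → Run m s (x ∷ w) m′ s′

Stack : ℕ → List ℕ → Set
Stack m s = AllPairs _>_ s × All (λ x → 1 ≤ x × x ≤ m) s

pops⇒∈ : (x , t) ∈ pops s → x ∈ s
pops⇒∈ {s = _ ∷ _} (here refl) = here refl
pops⇒∈ {s = _ ∷ _} (there p)   = there (pops⇒∈ p)

pops-tail : (x , t) ∈ pops s → y ∈ t → y ∈ s
pops-tail {s = _ ∷ _} (here refl) q = there q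
pops-tail {s = _ ∷ _} (there p)   q = there (pops-tail p q)

pops-∷ : (x , t) ∈ pops s → y ∈ x ∷ t → y ∈ s
pops-∷ p (here refl) = pops⇒∈ p
pops-∷ p (there q)   = pops-tail p q

∈⇒pops : x ∈ s → ∃ λ t → (x , t) ∈ pops s
∈⇒pops (here refl) = _ , here refl
∈⇒pops (there p)   = let t , q = ∈⇒pops p in t , there q

stack-new : Stack m s → Stack (suc m) (suc m ∷ s)
stack-new (d , bd) = All.map (s≤s ∘ proj₂) bd ∷ d , (s≤s z≤n , ≤-refl) ∷ All.map (λ (p , q) → p , m≤n⇒m≤1+n q) bd

stack-old : Stack m s → (x , t) ∈ pops s → Stack m (x ∷ t)
stack-old {s = _ ∷ _} st            (here refl) = st
stack-old {s = _ ∷ _} (_ ∷ d , _ ∷ bd) (there p) = stack-old (d , bd) p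

-- A discarded letter is lost for good, and every pushed letter exceeds `m`.
run-letters : Run m s w m′ s′ → x ∈ w → x ∈ s ⊎ m < x
run-letters (new r)   (here refl) = inj₂ ≤-refl
run-letters (old p r) (here refl) = inj₁ (pops⇒∈ p)
run-letters (new r)   (there q) with run-letters r q
... | inj₁ (here refl) = inj₂ ≤-refl
... | inj₁ (there q′)  = inj₁ q′
... | inj₂ lt          = inj₂ (<⇒≤ lt)
run-letters (old p r) (there q) with run-letters r q
... | inj₁ q′ = inj₁ (pops-∷ p q′)
... | inj₂ lt = inj₂ lt

-- Reading `a` clears all larger letters off the stack, and whatever is pushed later exceeds the
-- current maximum, hence `b`.
run-no-descent-return : Stack m s → Run m s w m′ s′ → a < b → b ≤ m → ¬ (a ∷ b ∷ [] ⊆ w)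
run-no-descent-return st (new r)   lt le (_ ∷ʳ sub)   = run-no-descent-return (stack-new st) r lt (m≤n⇒m≤1+n le) sub
run-no-descent-return st (old p r) lt le (_ ∷ʳ sub)   = run-no-descent-return (stack-old st p) r lt le sub
run-no-descent-return st (new r)   lt le (refl ∷ sub) = <⇒≱ lt (<⇒≤ (s≤s le))
run-no-descent-return st (old p r) lt le (refl ∷ sub)
  with run-letters r (Sublist.lookup sub (here refl)) | stack-old st p
... | inj₁ (here refl) | _         = <-irrefl refl lt
... | inj₁ (there q)   | as ∷ _ , _ = <-asym lt (All.lookup as q)
... | inj₂ gt          | _         = <⇒≱ gt le

-- Once `b` has been read it is at most the current maximum, so the previous lemma applies to the
-- rest.
run-no-bab : Stack m s → Run m s w m′ s′ → a < b → ¬ (b ∷ a ∷ b ∷ [] ⊆ w)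
run-no-bab st (new r)   lt (_ ∷ʳ sub)   = run-no-bab (stack-new st) r lt sub
run-no-bab st (old p r) lt (_ ∷ʳ sub)   = run-no-bab (stack-old st p) r lt sub
run-no-bab st (new r)   lt (refl ∷ sub) = run-no-descent-return (stack-new st) r lt ≤-refl sub
run-no-bab st (old p r) lt (refl ∷ sub) with stack-old st p
... | st′@(_ , (_ , le) ∷ _) = run-no-descent-return st′ r lt le sub

run⇒nonCrossing : Stack m s → Run m s w m′ s′ → NonCrossing w
run⇒nonCrossing st r a b lt sub = run-no-bab st r lt (drop-head sub)
  where
  drop-head : ∀ {w} → a ∷ b ∷ a ∷ b ∷ [] ⊆ w → b ∷ a ∷ b ∷ [] ⊆ w
  drop-head (y ∷ʳ sub) = y ∷ʳ drop-head sub
  drop-head (refl ∷ sub) = a ∷ʳ sub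

-- Restricted growth words, as continuations of a word with maximum `m`.
data Growth : ℕ → List ℕ → Set where
  []  : Growth m []
  new : Growth (suc m) w → Growth m (suc m ∷ w)
  old : 1 ≤ x → x ≤ m → Growth m w → Growth m (x ∷ w)

run⇒growth : Stack m s → Run m s w m′ s′ → Growth m w
run⇒growth st []        = []
run⇒growth st (new r)   = new (run⇒growth (stack-new st) r)
run⇒growth st (old p r) = let l , u = All.lookup (proj₂ st) (pops⇒∈ p) in old l u (run⇒growth (stack-old st p) r)

-- The three hypotheses form an invariant. Reading a new letter `b` turns the ban on `b a b` into a
-- ban on `a b` in the rest; reading an old `x` discards only letters above `x`, and by the ban on
-- `a b` these do not occur again.
growth⇒run : Stack m s → Growth m w →
  (∀ {x} → x ∈ w → x ≤ m → x ∈ s) →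
  (∀ {a b} → a < b → b ≤ m → ¬ (a ∷ b ∷ [] ⊆ w)) →
  (∀ {a b} → a < b → ¬ (b ∷ a ∷ b ∷ [] ⊆ w)) →
  ∃₂ (Run m s w)
growth⇒run st [] open? ab bab = _ , _ , []
growth⇒run {m} {s} {w = _ ∷ w} st (new g) open? ab bab =
  let _ , _ , r = growth⇒run (stack-new st) g open′ ab′ (λ lt sub → bab lt (_ ∷ʳ sub)) in _ , _ , new r
  where
  open′ : ∀ {x} → x ∈ w → x ≤ suc m → x ∈ suc m ∷ s
  open′ q le with m≤n⇒m<n∨m≡n le
  ... | inj₁ (s≤s le′) = there (open? (there q) le′)
  ... | inj₂ refl      = here refl
  ab′ : ∀ {a b} → a < b → b ≤ suc m → ¬ (a ∷ b ∷ [] ⊆ w)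
  ab′ lt le sub with m≤n⇒m<n∨m≡n le
  ... | inj₁ (s≤s le′) = ab lt le′ (_ ∷ʳ sub)
  ... | inj₂ refl      = bab lt (refl ∷ sub)
growth⇒run {m} {s} {w = x ∷ w} st (old l u g) open? ab bab =
  let _ , p = ∈⇒pops (open? (here refl) u)
      _ , _ , r = growth⇒run (stack-old st p) g
        (λ q le → still-open st p (open? (there q) le) (λ lt → ab lt le (refl ∷ Sublist.from∈ q)))
        (λ lt le sub → ab lt le (_ ∷ʳ sub)) (λ lt sub → bab lt (_ ∷ʳ sub))
  in _ , _ , old p r
  where
  still-open : ∀ {s t y} → Stack m s → (x , t) ∈ pops s → y ∈ s → ¬ x < y → y ∈ x ∷ t
  still-open {_ ∷ _} _ (here refl) q nlt = q
  still-open {_ ∷ _} (as ∷ d , _ ∷ bd) (there p) (here refl) nlt = contradiction (All.lookup as (pops⇒∈ p)) nlt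
  still-open {_ ∷ _} (as ∷ d , _ ∷ bd) (there p) (there q)   nlt = still-open (d , bd) p q nlt

-- Restricted growth words as canonical forms of set partitions

Closed : ∀ {n} → ℕ → (Fin n → ℕ) → Set
Closed m f = (∀ i → 1 ≤ f i) × (∀ i y → 1 ≤ y → y < f i → y ≤ m ⊎ ∃ λ i′ → i′ Fin.< i × f i′ ≡ y)

-- `Closed` is restricted growth stated by positions, the form that compares directly with blocks
-- and their minima. The first letter cannot exceed `suc m`, since `suc m` would have to occur
-- before it.
closed⇒growth : ∀ {n} m (f : Fin n → ℕ) → Closed m f → Growth m (tabulate f)
closed⇒growth {zero}  m f _ = []
closed⇒growth {suc n} m f (pos , cl) with <-cmp (f Fin.zero) (suc m)
... | tri> _ _ gt with cl Fin.zero (suc m) (s≤s z≤n) gt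
...   | inj₁ le           = contradiction le 1+n≰n
...   | inj₂ (_ , () , _)
closed⇒growth {suc n} m f (pos , cl) | tri≈ _ eq _ = subst (λ x → Growth m (x ∷ tabulate (f ∘ Fin.suc))) (sym eq)
  (new (closed⇒growth (suc m) (f ∘ Fin.suc) (pos ∘ Fin.suc , cl′)))
  where
  cl′ : ∀ i y → 1 ≤ y → y < f (Fin.suc i) → y ≤ suc m ⊎ ∃ λ i′ → i′ Fin.< i × f (Fin.suc i′) ≡ y
  cl′ i y l u with cl (Fin.suc i) y l u
  ... | inj₁ le                     = inj₁ (m≤n⇒m≤1+n le)
  ... | inj₂ (Fin.zero , _ , refl)  = inj₁ (≤-reflexive eq)
  ... | inj₂ (Fin.suc i′ , lt , eq′) = inj₂ (i′ , s≤s⁻¹ lt , eq′)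
closed⇒growth {suc n} m f (pos , cl) | tri< lt _ _ =
  old (pos Fin.zero) (s≤s⁻¹ lt) (closed⇒growth m (f ∘ Fin.suc) (pos ∘ Fin.suc , cl′))
  where
  cl′ : ∀ i y → 1 ≤ y → y < f (Fin.suc i) → y ≤ m ⊎ ∃ λ i′ → i′ Fin.< i × f (Fin.suc i′) ≡ y
  cl′ i y l u with cl (Fin.suc i) y l u
  ... | inj₁ le                      = inj₁ le
  ... | inj₂ (Fin.zero , _ , refl)   = inj₁ (s≤s⁻¹ lt)
  ... | inj₂ (Fin.suc i′ , lt , eq′) = inj₂ (i′ , s≤s⁻¹ lt , eq′)

growth⇒closed : Growth m w → Closed m (lookup w)
growth⇒closed g = positive g , preceded g
  where
  positive : Growth m w → ∀ i → 1 ≤ lookup w i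
  positive (new g)     Fin.zero    = s≤s z≤n
  positive (old l u g) Fin.zero    = l
  positive (new g)     (Fin.suc i) = positive g i
  positive (old l u g) (Fin.suc i) = positive g i
  preceded : Growth m w → ∀ i y → 1 ≤ y → y < lookup w i →
             y ≤ m ⊎ ∃ λ i′ → i′ Fin.< i × lookup w i′ ≡ y
  preceded (new g)     Fin.zero y l lt = inj₁ (s≤s⁻¹ lt)
  preceded (old _ u g) Fin.zero y l lt = inj₁ (≤-trans (<⇒≤ lt) u)
  preceded (new g) (Fin.suc i) y l lt with preceded g i y l lt
  ... | inj₂ (i′ , lt′ , eq) = inj₂ (Fin.suc i′ , s≤s lt′ , eq)
  ... | inj₁ le with m≤n⇒m<n∨m≡n le
  ...   | inj₁ (s≤s le′) = inj₁ le′
  ...   | inj₂ refl      = inj₂ (Fin.zero , s≤s z≤n , refl)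
  preceded (old _ _ g) (Fin.suc i) y l lt with preceded g i y l lt
  ... | inj₁ le              = inj₁ le
  ... | inj₂ (i′ , lt′ , eq) = inj₂ (Fin.suc i′ , s≤s lt′ , eq)

-- A smaller letter names an earlier block, whose minimum precedes the minimum of the block of `i`,
-- hence precedes `i`.
letter-closed : ∀ {n} (P : SetPartition n) → Closed 0 (SetPartition.letter P)
letter-closed {n} P = (λ i → s≤s z≤n) , λ i y l u → inj₂ (preceded i y l u)
  where
  open SetPartition P
  preceded : ∀ i y → 1 ≤ y → y < letter i → ∃ λ i′ → i′ Fin.< i × letter i′ ≡ y
  preceded i (suc y) _ (s≤s lt) =
    least j ,
    <-≤-trans (ordered {j} {j′} (subst (_< toℕ j′) (sym (Fin.toℕ-fromℕ< _)) lt)) (least-≤ (proj₂ (cover i))) ,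
    cong suc (trans (cong toℕ (disjoint (proj₂ (cover (least j))) (least-∈ j))) (Fin.toℕ-fromℕ< _))
    where
    j′ = proj₁ (cover i)
    j  = fromℕ< (<-trans lt (Fin.toℕ<n j′))

first-position : ∀ {n} (f : Fin n → ℕ) x → (∃ λ i → f i ≡ x) →
                 ∃ λ i → f i ≡ x × (∀ i′ → f i′ ≡ x → i Fin.≤ i′)
first-position {suc n} f x (i , eq) with f Fin.zero ≟ x
... | yes eq₀ = Fin.zero , eq₀ , λ _ _ → z≤n
first-position {suc n} f x (Fin.zero , eq)  | no neq = contradiction eq neq
first-position {suc n} f x (Fin.suc i , eq) | no neq =
  let j , eq′ , least = first-position (f ∘ Fin.suc) x (i , eq) in
  Fin.suc j , eq′ , λ { Fin.zero eq₀ → contradiction eq₀ neq ; (Fin.suc i′) eq″ → s≤s (least i′ eq″) }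

maximum : ∀ {n} (f : Fin n → ℕ) → ∃ λ k → (∀ i → f i ≤ k) × (k ≡ 0 ⊎ ∃ λ i → f i ≡ k)
maximum {zero}  f = 0 , (λ ()) , inj₁ refl
maximum {suc n} f with maximum (f ∘ Fin.suc)
... | k , bd , at with ≤-total (f Fin.zero) k
...   | inj₂ ge = f Fin.zero , (λ { Fin.zero → ≤-refl ; (Fin.suc i) → ≤-trans (bd i) ge }) , inj₂ (Fin.zero , refl)
...   | inj₁ le = k , (λ { Fin.zero → le ; (Fin.suc i) → bd i }) , shift at
  where
  shift : k ≡ 0 ⊎ (∃ λ i → f (Fin.suc i) ≡ k) → k ≡ 0 ⊎ ∃ λ i → f i ≡ k
  shift (inj₁ eq)       = inj₁ eq
  shift (inj₂ (i , eq)) = inj₂ (Fin.suc i , eq)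

-- The blocks are the fibres of `f`, and their number is its maximum (0 if there are no positions).
-- Closedness makes every value up to the maximum occur and orders the first occurrences.
closed⇒partition : ∀ {n} (f : Fin n → ℕ) → Closed 0 f →
                   ∃ λ (P : SetPartition n) → ∀ i → SetPartition.letter P i ≡ f i
closed⇒partition {n} f (pos , cl) = P , λ i → proj₂ (index i)
  where
  k = proj₁ (maximum f)

  occurs : ∀ y → 1 ≤ y → y ≤ k → ∃ λ i → f i ≡ y
  occurs y l u with proj₂ (proj₂ (maximum f))
  ... | inj₁ k≡0 = contradiction (≤-trans l (≤-trans u (≤-reflexive k≡0))) 1+n≰n
  ... | inj₂ (i , eq) with m≤n⇒m<n∨m≡n u
  ...   | inj₂ y≡k = i , trans eq (sym y≡k)
  ...   | inj₁ lt with cl i y l (subst (y <_) (sym eq) lt)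
  ...     | inj₁ y≤0           = contradiction (≤-trans l y≤0) 1+n≰n
  ...     | inj₂ (i′ , _ , eq′) = i′ , eq′

  index : ∀ i → ∃ λ (j : Fin k) → suc (toℕ j) ≡ f i
  index i with f i | pos i | proj₁ (proj₂ (maximum f)) i
  ... | suc y | _ | lt = fromℕ< lt , cong suc (Fin.toℕ-fromℕ< lt)

  fibre : Fin k → Subset.Subset n
  fibre j = Vec.tabulate λ i → does (f i ≟ suc (toℕ j))

  fibre⁺ : ∀ {i j} → f i ≡ suc (toℕ j) → i Subset.∈ fibre j
  fibre⁺ {i} {j} eq = Vec.lookup⇒[]= i _
    (trans (Vec.lookup∘tabulate _ i) (dec-true (f i ≟ suc (toℕ j)) eq))

  fibre⁻ : ∀ {i j} → i Subset.∈ fibre j → f i ≡ suc (toℕ j)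
  fibre⁻ {i} {j} i∈ = witness (f i ≟ suc (toℕ j))
    (trans (sym (Vec.lookup∘tabulate _ i)) (Vec.[]=⇒lookup i∈))
    where
    witness : ∀ {A : Set} (a? : Dec A) → does a? ≡ true → A
    witness (yes a) _ = a

  first : ∀ j → ∃ λ i → f i ≡ suc (toℕ j) × (∀ i′ → f i′ ≡ suc (toℕ j) → i Fin.≤ i′)
  first j = first-position f _ (occurs (suc (toℕ j)) (s≤s z≤n) (Fin.toℕ<n j))

  P : SetPartition n
  P = record
    { size     = k
    ; block    = fibre
    ; cover    = λ i → proj₁ (index i) , fibre⁺ (sym (proj₂ (index i)))
    ; disjoint = λ p q → Fin.toℕ-injective (suc-injective (trans (sym (fibre⁻ p)) (fibre⁻ q)))
    ; least    = λ j → proj₁ (first j)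
    ; least-∈  = λ j → fibre⁺ (proj₁ (proj₂ (first j)))
    ; least-≤  = λ {_} {j} p → proj₂ (proj₂ (first j)) _ (fibre⁻ p)
    ; ordered  = λ {j} {j′} lt → ordered′ j j′ lt
    }
    where
    ordered′ : ∀ j j′ → j Fin.< j′ → proj₁ (first j) Fin.< proj₁ (first j′)
    ordered′ j j′ lt with cl (proj₁ (first j′)) (suc (toℕ j)) (s≤s z≤n)
                            (subst (suc (toℕ j) <_) (sym (proj₁ (proj₂ (first j′)))) (s≤s lt))
    ... | inj₁ ()
    ... | inj₂ (i , i< , eq) = ≤-<-trans (proj₂ (proj₂ (first j)) i eq) i<

canonical⇒growth : ∀ {n} → IsCanonicalForm n w → Growth 0 w
canonical⇒growth (P , refl) = closed⇒growth 0 (SetPartition.letter P) (letter-closed P)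

growth⇒canonical : Growth 0 w → IsCanonicalForm (length w) w
growth⇒canonical {w} g =
  let P , eq = closed⇒partition (lookup w) (growth⇒closed g) in P , trans (tabulate-cong eq) (tabulate-lookup w)

empty-stack : Stack 0 []
empty-stack = [] , []

growth-positive : Growth m w → All (1 ≤_) w
growth-positive []          = []
growth-positive (new g)     = s≤s z≤n ∷ growth-positive g
growth-positive (old l _ g) = l ∷ growth-positive g

-- Letters above `m` first appear in increasing order. This extends `b a b` to `a b a b`, so a
-- non-crossing canonical form avoids `b a b` as well.
growth-precedes : ∀ {v} → Growth m w → m < a → a < b → b ∷ v ⊆ w → a ∷ b ∷ v ⊆ w
growth-precedes (new g) m<a a<b (refl ∷ _) = contradiction (≤-trans m<a (s≤s⁻¹ a<b)) 1+n≰n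
growth-precedes (new g) m<a a<b (_ ∷ʳ sub) with m≤n⇒m<n∨m≡n m<a
... | inj₁ lt   = _ ∷ʳ growth-precedes g lt a<b sub
... | inj₂ refl = refl ∷ sub
growth-precedes (old _ u _) m<a a<b (refl ∷ _) = contradiction (≤-trans (≤-trans m<a (<⇒≤ a<b)) u) 1+n≰n
growth-precedes (old _ _ g) m<a a<b (_ ∷ʳ sub) = _ ∷ʳ growth-precedes g m<a a<b sub

nc⇒run : ∀ {n} → IsNC n w → ∃₂ (Run 0 [] w)
nc⇒run (can , nc) = growth⇒run empty-stack g (λ q le → contradiction le (<⇒≱ (All.lookup (growth-positive g) q)))
  (λ { () z≤n }) no-bab
  where
  g = canonical⇒growth can
  no-bab : ∀ {a b} → a < b → ¬ (b ∷ a ∷ b ∷ [] ⊆ _)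
  no-bab lt sub = nc _ _ lt (growth-precedes g (All.lookup (growth-positive g) (Sublist.lookup sub (there (here refl)))) lt sub)

run⇒nc : Run 0 [] w m′ s′ → IsNC (length w) w
run⇒nc r = growth⇒canonical (run⇒growth empty-stack r) , run⇒nonCrossing empty-stack r

canonical-length : ∀ {n} → IsCanonicalForm n w → length w ≡ n
canonical-length (P , refl) = length-tabulate (SetPartition.letter P)

-- Enumeration of the non-crossing words

private
  variable
    A B : Set
    l m″ : ℕ
    s″ : List ℕ
    f g : A → ℕ

-- Finite sums over lists

sum-cong : {xs : List A} → (∀ {x} → x ∈ xs → f x ≡ g x) → sum (map f xs) ≡ sum (map g xs)
sum-cong eq = cong sum (map-cong-local (All.tabulate eq))

sum-zero : {xs : List A} → (∀ {x} → x ∈ xs → f x ≡ 0) → sum (map f xs) ≡ 0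
sum-zero {xs = []}     eq = refl
sum-zero {xs = x ∷ xs} eq = cong₂ _+_ (eq (here refl)) (sum-zero (eq ∘ there))

sum-single : {xs : List A} {x₀ : A} (key : A → B) → AllPairs (λ x y → key x ≢ key y) xs → x₀ ∈ xs →
             (∀ {x} → x ∈ xs → key x ≢ key x₀ → f x ≡ 0) → sum (map f xs) ≡ f x₀
sum-single {f = f} {x₀ = x₀} key (ne ∷ _) (here refl) zeros =
  trans (cong (f x₀ +_) (sum-zero λ p → zeros (there p) (≢-sym (All.lookup ne p)))) (+-identityʳ _)
sum-single key (ne ∷ nes) (there p) zeros =
  cong₂ _+_ (zeros (here refl) (All.lookup ne p)) (sum-single key nes p (zeros ∘ there))

sum-+ : (f g : A → ℕ) (xs : List A) → sum (map (λ x → f x + g x) xs) ≡ sum (map f xs) + sum (map g xs)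
sum-+ f g []       = refl
sum-+ f g (x ∷ xs) = trans (cong (f x + g x +_) (sum-+ f g xs)) (interchange (f x) (g x) _ _)

sum-swap : (h : A → B → ℕ) (xs : List A) (ys : List B) →
           sum (map (λ x → sum (map (h x) ys)) xs) ≡ sum (map (λ y → sum (map (λ x → h x y) xs)) ys)
sum-swap h [] ys = sym (sum-zero {xs = ys} λ _ → refl)
sum-swap h (x ∷ xs) ys = trans (cong (sum (map (h x) ys) +_) (sum-swap h xs ys)) (sym (sum-+ (h x) _ ys))

sum-concatMap : (f : B → ℕ) (h : A → List B) (xs : List A) →
                sum (map f (concatMap h xs)) ≡ sum (map (λ x → sum (map f (h x))) xs)
sum-concatMap f h []       = refl
sum-concatMap f h (x ∷ xs) = begin
  sum (map f (h x ++ concatMap h xs))                        ≡⟨ cong sum (map-++ f (h x) _) ⟩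
  sum (map f (h x) ++ map f (concatMap h xs))                ≡⟨ sum-++ (map f (h x)) _ ⟩
  sum (map f (h x)) + sum (map f (concatMap h xs))           ≡⟨ cong (sum (map f (h x)) +_) (sum-concatMap f h xs) ⟩
  sum (map f (h x)) + sum (map (λ x → sum (map f (h x))) xs) ∎
  where open ≡-Reasoning

-- (m′ , y , t) stands for reading the letter y and reaching the state m′, y ∷ t.
steps : ℕ → List ℕ → List (ℕ × ℕ × List ℕ)
steps m s = (suc m , suc m , s) ∷ map (m ,_) (pops s)

-- The words of length `l` readable from the state `m`, `s`, arranged by first letter so that sums
-- over them obey recurrences.
gen : ℕ → ℕ → List ℕ → List (List ℕ)
branch : ℕ → ℕ × ℕ × List ℕ → List (List ℕ)

gen zero    m s = [] ∷ []
gen (suc l) m s = concatMap (branch l) (steps m s)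

branch l (m′ , y , t) = map (y ∷_) (gen l m′ (y ∷ t))

total : (List ℕ → ℕ) → ℕ → ℕ → List ℕ → ℕ
total f l m s = sum (map f (gen l m s))

total-suc : ∀ f l m s → total f (suc l) m s ≡
            sum (map (λ (m′ , y , t) → total (f ∘ (y ∷_)) l m′ (y ∷ t)) (steps m s))
total-suc f l m s = trans (sum-concatMap f (branch l) (steps m s))
  (sum-cong {xs = steps m s} λ { {m′ , y , t} _ → cong sum (sym (map-∘ (gen l m′ (y ∷ t)))) })

steps-run : (m′ , y , t) ∈ steps m s → Run m′ (y ∷ t) w m″ s″ → Run m s (y ∷ w) m″ s″
steps-run (here refl) r = new r
steps-run (there p)   r with ∈-map⁻ _ p
... | _ , q , refl = old q r

steps-stack : Stack m s → (m′ , y , t) ∈ steps m s → Stack m′ (y ∷ t)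
steps-stack st (here refl) = stack-new st
steps-stack st (there p) with ∈-map⁻ _ p
... | _ , q , refl = stack-old st q

pops-decreasing : Stack m s → AllPairs (λ p q → proj₁ p > proj₁ q) (pops s)
pops-decreasing {s = []}    _                 = []
pops-decreasing {s = x ∷ s} (as ∷ d , _ ∷ bd) =
  All.tabulate (λ p → All.lookup as (pops⇒∈ p)) ∷ pops-decreasing (d , bd)

letterOf : ℕ × ℕ × List ℕ → ℕ
letterOf (_ , y , _) = y

steps-distinct : Stack m s → AllPairs (λ p q → letterOf p ≢ letterOf q) (steps m s)
steps-distinct st@(_ , bd) =
  All.map⁺ (All.tabulate λ p → >⇒≢ (s≤s (proj₂ (All.lookup bd (pops⇒∈ p))))) ∷
  AllPairs.map⁺ (AllPairs.map >⇒≢ (pops-decreasing st))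

gen-sound : ∀ l → w ∈ gen l m s → length w ≡ l × ∃₂ (Run m s w)
gen-sound zero    (here refl) = refl , _ , _ , []
gen-sound {m = m} {s} (suc l) w∈ = go (steps m s) (λ p → p) (∈-concatMap⁻ (branch l) w∈)
  where
  go : ∀ xs → (∀ {σ} → σ ∈ xs → σ ∈ steps m s) →
       Any (λ σ → w ∈ branch l σ) xs → length w ≡ suc l × ∃₂ (Run m s w)
  go (_ ∷ xs) sub (there q) = go xs (sub ∘ there) q
  go (_ ∷ xs) sub (here q) with ∈-map⁻ _ q
  ... | _ , q′ , refl = let len , _ , _ , r = gen-sound l q′ in cong suc len , _ , _ , steps-run (sub (here refl)) r

run⇒∈gen : Run m s w m′ s′ → w ∈ gen (length w) m s
run⇒∈gen []        = here refl
run⇒∈gen {m} {s} {_ ∷ w} (new r)   = ∈-concatMap⁺ (branch (length w)) {xs = steps m s} (here (∈-map⁺ _ (run⇒∈gen r)))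
run⇒∈gen {m} {s} {_ ∷ w} (old p r) = ∈-concatMap⁺ (branch (length w)) {xs = steps m s}
  (there (Any.map (λ { refl → ∈-map⁺ _ (run⇒∈gen r) }) (∈-map⁺ _ p)))

gen-unique : ∀ l → Stack m s → Unique (gen l m s)
gen-unique zero    st = [] ∷ []
gen-unique (suc l) st = Unique.concat⁺
  (All.map⁺ (All.tabulate λ { {m′ , y , t} p → Unique.map⁺ ∷-injectiveʳ (gen-unique l (steps-stack st p)) }))
  (AllPairs.map⁺ (AllPairs.map (λ {p} {q} → disjoint {p} {q}) (steps-distinct st)))
  where
  disjoint : ∀ {p q} → letterOf p ≢ letterOf q → Disjoint (branch l p) (branch l q)
  disjoint ne (u∈ , v∈) with ∈-map⁻ _ u∈ | ∈-map⁻ _ v∈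
  ... | _ , _ , refl | _ , _ , eq = ne (proj₁ (∷-injective eq))

total-cong : ∀ l → (∀ w → length w ≡ l → ∃₂ (Run m s w) → f w ≡ g w) → total f l m s ≡ total g l m s
total-cong l eq = sum-cong λ p → let len , r = gen-sound l p in eq _ len r

-- Both lists are free of duplicates, so having the same members suffices.
NC↭gen : ∀ n → NC n ↭ gen n 0 []
NC↭gen n = ∼bag⇒↭ (unique∧set⇒bag (NC-unique n) (gen-unique n empty-stack) (mk⇔ to from))
  where
  to : w ∈ NC n → w ∈ gen n 0 []
  to {w} p =
    let can , nc = Equivalence.to (∈-NC⇔ {n}) p
        _ , _ , r = nc⇒run (can , nc)
    in subst (λ l → w ∈ gen l 0 []) (canonical-length can) (run⇒∈gen r)
  from : w ∈ gen n 0 [] → w ∈ NC n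
  from {w} p with gen-sound {w} n p
  ... | refl , _ , _ , r = Equivalence.from (∈-NC⇔ {length w}) (run⇒nc r)

-- The stacks beneath the letters of `s` take each height below `length s` exactly once. Here the
-- count forgets the letters and keeps only the height.
sum-pops : (F : ℕ → ℕ) → ∀ s → sum (map (λ (_ , t) → F (length t)) (pops s)) ≡ below F (length s)
sum-pops F []      = refl
sum-pops F (x ∷ s) = cong (F (length s) +_) (sum-pops F s)

sum-steps : (F : ℕ → ℕ) → ∀ m s → sum (map (λ (_ , _ , t) → F (length t)) (steps m s)) ≡ below F (suc (length s))
sum-steps F m s = cong (F (length s) +_) (trans (cong sum (sym (map-∘ (pops s)))) (sum-pops F s))

total-one : ∀ l m s → total (λ _ → 1) l m s ≡ runs l (length s)
total-one zero    m s = refl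
total-one (suc l) m s = trans (total-suc _ l m s)
  (trans (sum-cong {xs = steps m s} λ { {m′ , y , t} _ → total-one l m′ (y ∷ t) })
         (sum-steps (λ j → runs l (suc j)) m s))

-- Occurrences

private
  variable
    P Q : Set
    M p q : ℕ
    u v ρ : List ℕ

𝟙 : Dec P → ℕ
𝟙 P? = if does P? then 1 else 0

𝟙-true : (P? : Dec P) → P → 𝟙 P? ≡ 1
𝟙-true P? p = cong (if_then 1 else 0) (dec-true P? p)

𝟙-false : (P? : Dec P) → ¬ P → 𝟙 P? ≡ 0
𝟙-false P? ¬p = cong (if_then 1 else 0) (dec-false P? ¬p)

𝟙-cong : (P? : Dec P) (Q? : Dec Q) → (P → Q) → (Q → P) → 𝟙 P? ≡ 𝟙 Q?
𝟙-cong (yes p) Q? to from = sym (𝟙-true Q? (to p))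
𝟙-cong (no ¬p) Q? to from = sym (𝟙-false Q? (¬p ∘ from))

length-filter-map : {P : B → Set} (P? : Decidable P) (h : A → B) (xs : List A) →
                    length (filter P? (map h xs)) ≡ length (filter (λ x → P? (h x)) xs)
length-filter-map P? h [] = refl
length-filter-map P? h (x ∷ xs) with does (P? (h x))
... | true  = cong suc (length-filter-map P? h xs)
... | false = length-filter-map P? h xs

length-filter-∷ : {P : A → Set} (P? : Decidable P) (x : A) (xs : List A) →
                  length (filter P? (x ∷ xs)) ≡ 𝟙 (P? x) + length (filter P? xs)
length-filter-∷ P? x xs with does (P? x)
... | true  = refl
... | false = refl

μ-short : ∀ τ w → length w < length τ → μ τ w ≡ 0
μ-short τ w lt rewrite m≤n⇒m∸n≡0 lt = refl

-- The window at position 0 is split off and the others are shifted. If it overruns the word, `take`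
-- yields a list too short to be order-isomorphic to the pattern, and both sides are 0.
μ-∷ : ∀ z τ x w → let τ′ = z ∷ τ in
      μ τ′ (x ∷ w) ≡ 𝟙 (orderIsomorphic? τ′ (take (length τ′) (x ∷ w))) + μ τ′ w
μ-∷ z τ x w with length τ ≤? length w
... | no nle = trans (μ-short (z ∷ τ) (x ∷ w) (s≤s (≰⇒> nle))) (sym (cong₂ _+_
  (𝟙-false (orderIsomorphic? (z ∷ τ) (x ∷ take (length τ) w)) λ (eq , _) →
    nle (≤-trans (≤-reflexive (trans (suc-injective eq) (length-take (length τ) w))) (m⊓n≤n (length τ) (length w))))
  (μ-short (z ∷ τ) w (m<n⇒m<1+n (≰⇒> nle)))))
... | yes le rewrite +-∸-assoc 1 le = trans
  (length-filter-∷ hit? 0 (applyUpTo suc N))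
  (cong (𝟙 (hit? 0) +_) (trans (cong (λ is → length (filter hit? is)) (sym (map-upTo suc N)))
                               (length-filter-map hit? suc (upTo N))))
  where
  N = length w ∸ length τ
  hit? : ∀ i → Dec (OrderIsomorphic (z ∷ τ) (take (length (z ∷ τ)) (drop i (x ∷ w))))
  hit? i = orderIsomorphic? (z ∷ τ) (take (length (z ∷ τ)) (drop i (x ∷ w)))

-- Order isomorphism and the shape of an occurrence

Agree : ℕ → ℕ → ℕ → ℕ → Set
Agree x y p q = (x < p ⇔ y < q) × (x ≡ p ⇔ y ≡ q) × (p < x ⇔ q < y)

-- Each letter is compared only with later ones, which suits an induction from left to right.
data Iso : List ℕ → List ℕ → Set where
  []  : Iso [] []
  _∷_ : Pointwise (Agree x y) u v → Iso u v → Iso (x ∷ u) (y ∷ v)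

lookup⇒pointwise : {R : A → B → Set} {xs : List A} {ys : List B} (eq : length xs ≡ length ys) →
                   (∀ i → R (lookup xs i) (lookup ys (Fin.cast eq i))) → Pointwise R xs ys
lookup⇒pointwise {xs = []}     {[]}     eq r = []
lookup⇒pointwise {xs = _ ∷ _}  {_ ∷ _}  eq r = r Fin.zero ∷ lookup⇒pointwise (suc-injective eq) (r ∘ Fin.suc)

orderIsomorphic⇒iso : OrderIsomorphic u v → Iso u v
orderIsomorphic⇒iso {[]}    {[]}    _        = []
orderIsomorphic⇒iso {_ ∷ _} {_ ∷ _} (eq , r) =
  lookup⇒pointwise (suc-injective eq) (λ i →
    let lt , ≡⇔ = r Fin.zero (Fin.suc i) in lt , ≡⇔ , proj₁ (r (Fin.suc i) Fin.zero)) ∷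
  orderIsomorphic⇒iso (suc-injective eq , λ i j → r (Fin.suc i) (Fin.suc j))

lookup-map : (h : A → B) (xs : List A) .(eq : length xs ≡ length (map h xs)) →
             ∀ i → lookup (map h xs) (Fin.cast eq i) ≡ h (lookup xs i)
lookup-map h (x ∷ xs) eq Fin.zero    = refl
lookup-map h (x ∷ xs) eq (Fin.suc i) = lookup-map h xs (suc-injective eq) i

monotone⇒orderIsomorphic : (h : ℕ → ℕ) → (∀ {p q} → p < q → h p < h q) → ∀ u → OrderIsomorphic u (map h u)
monotone⇒orderIsomorphic h mono u = eq , λ i j → rel i j
  where
  eq = sym (length-map h u)
  cancel-< : ∀ {p q} → h p < h q → p < q
  cancel-< {p} {q} lt with <-cmp p q
  ... | tri< p<q _ _  = p<q
  ... | tri≈ _ refl _ = contradiction lt (<-irrefl refl)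
  ... | tri> _ _ q<p  = contradiction lt (<-asym (mono q<p))
  cancel-≡ : ∀ {p q} → h p ≡ h q → p ≡ q
  cancel-≡ {p} {q} e with <-cmp p q
  ... | tri< p<q _ _ = contradiction e (<⇒≢ (mono p<q))
  ... | tri≈ _ e′ _  = e′
  ... | tri> _ _ q<p = contradiction e (>⇒≢ (mono q<p))
  rel : ∀ i j → (lookup u i < lookup u j ⇔ lookup (map h u) (Fin.cast eq i) < lookup (map h u) (Fin.cast eq j)) ×
                (lookup u i ≡ lookup u j ⇔ lookup (map h u) (Fin.cast eq i) ≡ lookup (map h u) (Fin.cast eq j))
  rel i j rewrite lookup-map h u eq i | lookup-map h u eq j = mk⇔ mono cancel-< , mk⇔ (cong h) cancel-≡

-- The first letter y of an occurrence and the largest letter m up to it determine the letters in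
-- place of ρ: the letter 1 of ρ becomes y, and the others become new letters m + 1, m + 2, …
-- (0 does not occur in ρ.)
place : ℕ → ℕ → ℕ → ℕ
place y m zero          = 0
place y m (suc zero)    = y
place y m (suc (suc k)) = m + suc k

-- Relabels all of `τ`: the final 1s become `x`, and `suc z`, which stands for the letter `z` of
-- `ρ`, becomes `place y m z`.
pattern-letters : ℕ → ℕ → ℕ → ℕ → ℕ
pattern-letters x y m zero          = 0
pattern-letters x y m (suc zero)    = x
pattern-letters x y m (suc (suc z)) = place y m (suc z)

step-monotone : (h : ℕ → ℕ) → (∀ k → h k < h (suc k)) → p < q → h p < h q
step-monotone h step lt = go (≤⇒≤′ lt)
  where
  go : ∀ {p q} → suc p ≤′ q → h p < h q
  go ≤′-refl       = step _
  go (≤′-step lt)  = <-trans (go lt) (step _)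

pattern-letters-monotone : 0 < x → x < y → y ≤ m → p < q → pattern-letters x y m p < pattern-letters x y m q
pattern-letters-monotone {x} {y} {m} 0<x x<y y≤m = step-monotone (pattern-letters x y m) step
  where
  step : ∀ k → pattern-letters x y m k < pattern-letters x y m (suc k)
  step zero                = 0<x
  step (suc zero)          = x<y
  step (suc (suc zero))    = ≤-trans (s≤s y≤m) (≤-reflexive (+-comm 1 m))
  step (suc (suc (suc k))) = +-monoʳ-< m (n<1+n (suc k))

constant : Pointwise (Agree p x) (replicate b p) v → v ≡ replicate b x
constant {b = zero}  []                     = refl
constant {b = suc b} ((_ , eq , _) ∷ rs) = cong₂ _∷_ (sym (Equivalence.to eq refl)) (constant rs)

growth-uncons : ∀ {q} → Growth m (q ∷ v) → (q ≡ suc m × Growth (suc m) v) ⊎ (q ≤ m × Growth m v)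
growth-uncons (new g)     = inj₁ (refl , g)
growth-uncons (old _ u g) = inj₂ (u , g)

-- Invariant: the letters of `ρ` seen so far are `1` to `suc M`, the maximum of the word is `m + M`,
-- and `known` compares each placed letter with the rest. A new letter of `ρ` must exceed all placed
-- ones and is therefore the next new letter of the word; an old one repeats its value; the first of
-- the final 1s falls below `y`.
iso⇒placed : y ≤ m → Growth (suc M) ρ → Growth (m + M) v → All (λ q → q ≤ y ⊎ m < q) v →
  (∀ z → 1 ≤ z → z ≤ suc M → Pointwise (Agree (suc z) (place y m z)) (map suc ρ ++ replicate (suc b) 1) v) →
  Iso (map suc ρ ++ replicate (suc b) 1) v →
  ∃ λ x → x < y × v ≡ map (place y m) ρ ++ replicate (suc b) x
iso⇒placed y≤m [] _ _ known (rs ∷ _) with known 1 ≤-refl (s≤s z≤n)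
... | (_ , _ , gt) ∷ _ = _ , Equivalence.to gt ≤-refl , cong (_ ∷_) (constant rs)
iso⇒placed {y} {m} {M} {v = q ∷ v} y≤m (new {w = ρ} g) g′ (or ∷ ors) known (rs ∷ iso) =
  let x , lt , eq = iso⇒placed y≤m g (subst (λ N → Growth N v) (sym (+-suc m M)) (proj₂ fresh)) ors known′ iso
  in x , lt , cong₂ _∷_ q≡ eq
  where
  above : place y m (suc M) < q
  above with known (suc M) (s≤s z≤n) ≤-refl
  ... | (lt , _) ∷ _ = Equivalence.to lt (n<1+n (suc (suc M)))
  -- For `M = 0` only `y` has been placed, and `y < q` alone would allow `q ≤ m`; the dichotomy for
  -- the letters of `v` rules this out. For larger `M` the last placed letter is already the
  -- maximum.
  too-small : ∀ M → place y m (suc M) < q → q ≤ y ⊎ m < q → ¬ q ≤ m + M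
  too-small zero    lt (inj₁ le) _   = <⇒≱ lt le
  too-small zero    lt (inj₂ gt) le  = <⇒≱ gt (subst (q ≤_) (+-identityʳ m) le)
  too-small (suc M) lt _         le  = <⇒≱ lt le
  fresh : q ≡ suc (m + M) × Growth (suc (m + M)) v
  fresh with growth-uncons g′
  ... | inj₁ f       = f
  ... | inj₂ (u , _) = contradiction u (too-small M above or)
  q≡ : q ≡ m + suc M
  q≡ = trans (proj₁ fresh) (sym (+-suc m M))
  known′ : ∀ z → 1 ≤ z → z ≤ suc (suc M) →
           Pointwise (Agree (suc z) (place y m z)) (map suc ρ ++ replicate _ 1) v
  known′ z l u with m≤n⇒m<n∨m≡n u
  ... | inj₁ (s≤s u′) = Pointwise.tail (known z l u′)
  ... | inj₂ refl     = subst (λ q → Pointwise (Agree _ q) _ _) q≡ rs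
iso⇒placed {y} {m} {M} {v = q ∷ v} y≤m (old {x = z} l u g) g′ (_ ∷ ors) known (rs ∷ iso) =
  let x , lt , eq = iso⇒placed y≤m g same ors (λ z l u → Pointwise.tail (known z l u)) iso
  in x , lt , cong₂ _∷_ q≡ eq
  where
  q≡ : q ≡ place y m z
  q≡ with known z l u
  ... | (_ , eq , _) ∷ _ = sym (Equivalence.to eq refl)
  bounded : ∀ z → z ≤ suc M → place y m z ≤ m + M
  bounded zero          _        = z≤n
  bounded (suc zero)    _        = ≤-trans y≤m (m≤m+n m M)
  bounded (suc (suc k)) (s≤s le) = +-monoʳ-≤ m le
  same : Growth (m + M) v
  same with growth-uncons g′
  ... | inj₁ (eq , _) = contradiction (subst (_≤ m + M) (trans (sym q≡) eq) (bounded z u)) 1+n≰n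
  ... | inj₂ (_ , g″) = g″

-- Relabelled runs and words with a prescribed beginning

take-prefix : (k : ℕ) (w : List A) → Prefix _≡_ (take k w) w
take-prefix zero    w       = []
take-prefix (suc k) []      = []
take-prefix (suc k) (x ∷ w) = refl ∷ take-prefix k w

prefix⇒take : {v w : List A} → Prefix _≡_ v w → take (length v) w ≡ v
prefix⇒take []         = refl
prefix⇒take (refl ∷ p) = cong (_ ∷_) (prefix⇒take p)

run-take : ∀ k → Run m s w m′ s′ → ∃₂ (Run m s (take k w))
run-take zero    r         = _ , _ , []
run-take (suc k) []        = _ , _ , []
run-take (suc k) (new r)   = let _ , _ , r′ = run-take k r in _ , _ , new r′
run-take (suc k) (old p r) = let _ , _ , r′ = run-take k r in _ , _ , old p r′

run-++ : Run m s u m′ s′ → Run m′ s′ v m″ s″ → Run m s (u ++ v) m″ s″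
run-++ []        r′ = r′
run-++ (new r)   r′ = new (run-++ r r′)
run-++ (old p r) r′ = old p (run-++ r r′)

run-repeat : ∀ b → (x , t) ∈ pops s → Run m s (replicate (suc b) x) m (x ∷ t)
run-repeat zero    p = old p []
run-repeat (suc b) p = old p (run-repeat b (here refl))

pops-map-++ : (h : ℕ → ℕ) → (x , s′) ∈ pops s → (h x , map h s′ ++ t) ∈ pops (map h s ++ t)
pops-map-++ {s = _ ∷ _} h (here refl) = here refl
pops-map-++ {s = _ ∷ _} h (there p)   = there (pops-map-++ h p)

pops-++ʳ : ∀ s → (x , s′) ∈ pops t → (x , s′) ∈ pops (s ++ t)
pops-++ʳ []      p = p
pops-++ʳ (_ ∷ s) p = there (pops-++ʳ s p)

-- A run of `ρ` can be replayed, relabelled, on top of any stack `t` without touching `t`; the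
-- maximum `suc M` corresponds to `m + M`.
run-place : ∀ y m t → Run (suc M) s ρ m′ s′ →
            ∃ λ N → Run (m + M) (map (place y m) s ++ t) (map (place y m) ρ) N (map (place y m) s′ ++ t)
run-place y m t []        = _ , []
run-place {M} {s} {s′ = s′} y m t (new {w = ρ} r) with run-place y m t r
... | N , r′ = N , subst (λ k → Run (m + M) (map (place y m) s ++ t) (k ∷ map (place y m) ρ) N (map (place y m) s′ ++ t)) (sym (+-suc m M))
  (new (subst (λ k → Run k (k ∷ map (place y m) s ++ t) (map (place y m) ρ) N (map (place y m) s′ ++ t)) (+-suc m M) r′))
run-place y m t (old p r) = let N , r′ = run-place y m t r in N , old (pops-map-++ (place y m) p) r′

starts : List ℕ → List ℕ → ℕ
starts v w = 𝟙 (prefix? _≟_ v w)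

run-uncons : Run m s (x ∷ w) m′ s′ → ∃₂ λ m″ t → (m″ , x , t) ∈ steps m s × Run m″ (x ∷ t) w m′ s′
run-uncons (new r)   = _ , _ , here refl , r
run-uncons (old p r) = _ , _ , there (∈-map⁺ _ p) , r

total-starts-∷ : ∀ v l → Stack m s → (m′ , x , t) ∈ steps m s →
                 total (starts (x ∷ v)) (suc l) m s ≡ total (starts v) l m′ (x ∷ t)
total-starts-∷ {m} {s} {m′} {x} {t} v l st σ∈ = begin
  total (starts (x ∷ v)) (suc l) m s
    ≡⟨ total-suc (starts (x ∷ v)) l m s ⟩
  sum (map after (steps m s))
    ≡⟨ sum-single {f = after} letterOf (steps-distinct st) σ∈ (λ { {σ} _ → mismatch σ }) ⟩
  after (m′ , x , t)
    ≡⟨ total-cong l (λ w _ _ →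
         𝟙-cong (prefix? _≟_ (x ∷ v) (x ∷ w)) (prefix? _≟_ v w) (λ { (_ ∷ p) → p }) (refl ∷_)) ⟩
  total (starts v) l m′ (x ∷ t) ∎
  where
  open ≡-Reasoning
  after : ℕ × ℕ × List ℕ → ℕ
  after (m″ , y , t) = total (λ w → starts (x ∷ v) (y ∷ w)) l m″ (y ∷ t)
  mismatch : ∀ σ → letterOf σ ≢ x → after σ ≡ 0
  mismatch (m″ , y , t) ne = sum-zero {xs = gen l m″ (y ∷ t)}
    (λ {w} _ → 𝟙-false (prefix? _≟_ (x ∷ v) (y ∷ w)) λ { (eq ∷ _) → ne (sym eq) })

-- Each prescribed letter selects exactly one step, so only the `l` letters after `v` are free.
total-starts : ∀ v l → Stack m s → Run m s v m′ s′ → total (starts v) (length v + l) m s ≡ runs l (length s′)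
total-starts {m} {s} []      l st [] = total-one l m s
total-starts         (x ∷ v) l st r  =
  let _ , _ , σ∈ , r′ = run-uncons r
  in trans (total-starts-∷ v (length v + l) st σ∈) (total-starts v l (steps-stack st σ∈) r′)

-- Here `ρ` is the canonical form without its initial 1, already read in the initial state of
-- `ρ-run`, and the number of final 1s is `suc b`.
module Occurrences (ρ : List ℕ) (b : ℕ) {M σ} (ρ-run : Run 1 (1 ∷ []) ρ M σ) where

  suffix τ : List ℕ
  suffix = map suc ρ ++ replicate (suc b) 1
  τ = 2 ∷ suffix

  filling : ℕ → ℕ → ℕ → List ℕ
  filling x y m = map (place y m) ρ ++ replicate (suc b) x

  ρ-growth : Growth 1 ρ
  ρ-growth = run⇒growth (stack-new empty-stack) ρ-run

  length-filling : ∀ x y m → length (filling x y m) ≡ length suffix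
  length-filling x y m = begin
    length (map (place y m) ρ ++ replicate (suc b) x)       ≡⟨ length-++ (map (place y m) ρ) ⟩
    length (map (place y m) ρ) + length (replicate (suc b) x)
      ≡⟨ cong₂ _+_ (trans (length-map (place y m) ρ) (sym (length-map suc ρ)))
                   (trans (length-replicate (suc b)) (sym (length-replicate (suc b)))) ⟩
    length (map suc ρ) + length (replicate (suc b) 1)       ≡⟨ length-++ (map suc ρ) ⟨
    length suffix                                           ∎
    where open ≡-Reasoning

  fill : ∀ x y m → map (pattern-letters x y m) τ ≡ y ∷ filling x y m
  fill x y m = cong (y ∷_) (begin
    map h (map suc ρ ++ replicate (suc b) 1)       ≡⟨ map-++ h (map suc ρ) _ ⟩
    map h (map suc ρ) ++ map h (replicate (suc b) 1)
      ≡⟨ cong₂ _++_ (trans (sym (map-∘ ρ)) (map-cong-local (All.map agree (growth-positive ρ-growth))))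
                    (map-replicate h (suc b) 1) ⟩
    filling x y m ∎)
    where
    open ≡-Reasoning
    h = pattern-letters x y m
    agree : ∀ {z} → 1 ≤ z → h (suc z) ≡ place y m z
    agree {suc z} _ = refl

  filling-injective : ∀ {x x′ y m} → Prefix _≡_ (filling x y m) w → Prefix _≡_ (filling x′ y m) w → x ≡ x′
  filling-injective {w} {x} {x′} {y} {m} p p′ = ∷-injectiveˡ (++-cancelˡ (map (place y m) ρ) _ _ (begin
    filling x y m                      ≡⟨ prefix⇒take p ⟨
    take (length (filling x y m)) w    ≡⟨ cong (λ k → take k w) (trans (length-filling x y m) (sym (length-filling x′ y m))) ⟩
    take (length (filling x′ y m)) w   ≡⟨ prefix⇒take p′ ⟩
    filling x′ y m                     ∎))
    where open ≡-Reasoning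

  -- As `y` is on top of the stack, a letter of the window is at most `y` or exceeds `m`, as
  -- `iso⇒placed` requires. The resulting `x` is below `y`, so it can only come from `t`.
  occurrence⇒filling : Stack m (y ∷ t) → Run m (y ∷ t) w m′ s′ → OrderIsomorphic τ (take (length τ) (y ∷ w)) →
                       ∃₂ λ x t′ → (x , t′) ∈ pops t × Prefix _≡_ (filling x y m) w
  occurrence⇒filling {m} {y} {t} {w} st@(_ , (_ , y≤m) ∷ _) r oi with orderIsomorphic⇒iso {τ} oi | run-take (length suffix) r
  ... | rs ∷ iso | _ , _ , r′ =
    let x , x<y , eq = iso⇒placed y≤m ρ-growth (subst (λ k → Growth k window) (sym (+-identityʳ m)) (run⇒growth st r′))
                         (All.tabulate λ q∈ → fresh-or-low (run-letters r′ q∈)) known iso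
        x∈window = subst (x ∈_) (sym eq) (∈-++⁺ʳ (map (place y m) ρ) (here refl))
        t′ , p = ∈⇒pops (below-top x<y (run-letters r′ x∈window))
    in x , t′ , p , subst (λ u → Prefix _≡_ u w) eq (take-prefix (length suffix) w)
    where
    window = take (length suffix) w
    fresh-or-low : ∀ {q} → q ∈ y ∷ t ⊎ m < q → q ≤ y ⊎ m < q
    fresh-or-low (inj₁ (here refl)) = inj₁ ≤-refl
    fresh-or-low (inj₁ (there q∈))  = inj₁ (<⇒≤ (All.lookup (AllPairs.head (proj₁ st)) q∈))
    fresh-or-low (inj₂ gt)          = inj₂ gt
    known : ∀ z → 1 ≤ z → z ≤ 1 → Pointwise (Agree (suc z) (place y m z)) suffix window
    known (suc zero) _ _ = rs
    known (suc (suc z)) _ (s≤s ())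
    below-top : ∀ {x} → x < y → x ∈ y ∷ t ⊎ m < x → x ∈ t
    below-top lt (inj₁ (here refl)) = contradiction lt 1+n≰n
    below-top lt (inj₁ (there q))   = q
    below-top lt (inj₂ gt)          = contradiction (≤-trans (<⇒≤ lt) y≤m) (<⇒≱ gt)

  filling⇒occurrence : Stack m (y ∷ t) → x ∈ t → Prefix _≡_ (filling x y m) w →
                       OrderIsomorphic τ (take (length τ) (y ∷ w))
  filling⇒occurrence {m} {y} {t} {x} {w} (xs ∷ _ , (_ , y≤m) ∷ bd) x∈ p =
    subst (OrderIsomorphic τ)
      (trans (fill x y m) (cong (y ∷_) (trans (sym (prefix⇒take p)) (cong (λ k → take k w) (length-filling x y m)))))
      (monotone⇒orderIsomorphic (pattern-letters x y m)
        (pattern-letters-monotone (proj₁ (All.lookup bd x∈)) (All.lookup xs x∈) y≤m) τ)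

  hits : ℕ → List ℕ → ℕ
  hits y w = 𝟙 (orderIsomorphic? τ (take (length τ) (y ∷ w)))

  -- At most one summand is nonzero, because `x` can be read off as the letter right after the copy
  -- of `ρ`.
  hits≡starts : Stack m (y ∷ t) → Run m (y ∷ t) w m′ s′ →
                hits y w ≡ sum (map (λ (x , _) → starts (filling x y m) w) (pops t))
  hits≡starts {m} {y} {t} {w} st@(_ ∷ d , _ ∷ bd) r with orderIsomorphic? τ (take (length τ) (y ∷ w))
  ... | no ¬oi = sym (sum-zero {xs = pops t} λ p → 𝟙-false (prefix? _≟_ _ w) (¬oi ∘ filling⇒occurrence st (pops⇒∈ p)))
  ... | yes oi =
    let x , t′ , p , pre = occurrence⇒filling st r oi in sym (trans
      (sum-single {f = λ (x , _) → starts (filling x y m) w} proj₁ (AllPairs.map >⇒≢ (pops-decreasing (d , bd))) p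
        (λ _ ne → 𝟙-false (prefix? _≟_ _ w) (λ pre′ → ne (filling-injective pre′ pre))))
      (𝟙-true (prefix? _≟_ (filling x y m) w) pre))

  -- With `x` fixed the whole filling is forced, and it leaves `x` on top of the letters beneath it,
  -- with `e` free letters to follow.
  hits-total : ∀ e → Stack m (y ∷ t) → total (hits y) (length suffix + e) m (y ∷ t) ≡ below (λ i → runs e (suc i)) (length t)
  hits-total {m} {y} {t} e st = begin
    total (hits y) len m (y ∷ t)
      ≡⟨ total-cong len (λ w _ (_ , _ , r) → hits≡starts st r) ⟩
    total (λ w → sum (map (λ (x , _) → starts (filling x y m) w) (pops t))) len m (y ∷ t)
      ≡⟨ sum-swap (λ w (x , _) → starts (filling x y m) w) (gen len m (y ∷ t)) (pops t) ⟩
    sum (map (λ (x , _) → total (starts (filling x y m)) len m (y ∷ t)) (pops t))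
      ≡⟨ sum-cong {xs = pops t} (λ { {x , t′} p → total-filling p }) ⟩
    sum (map (λ (_ , t′) → runs e (suc (length t′))) (pops t))
      ≡⟨ sum-pops (λ i → runs e (suc i)) t ⟩
    below (λ i → runs e (suc i)) (length t) ∎
    where
    open ≡-Reasoning
    len = length suffix + e
    filling-run : ∀ {x t′} → (x , t′) ∈ pops t → ∃ λ N → Run m (y ∷ t) (filling x y m) N (x ∷ t′)
    filling-run p with run-place y m t ρ-run
    ... | N , r rewrite +-identityʳ m = N , run-++ r (run-repeat b (pops-++ʳ (map (place y m) σ) p))
    total-filling : ∀ {x t′} → (x , t′) ∈ pops t → total (starts (filling x y m)) len m (y ∷ t) ≡ runs e (suc (length t′))
    total-filling {x} p = trans
      (cong (λ k → total (starts (filling x y m)) (k + e) m (y ∷ t)) (sym (length-filling x y m)))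
      (total-starts (filling x y m) e st (proj₂ (filling-run p)))

  -- Induction on the first letter: an occurrence starts there or lies in the rest. For `e = 0` the
  -- word is one letter shorter than `τ`.
  μ-total : ∀ e → Stack m s → total (μ τ) (length suffix + e) m s ≡ descents e (length s)
  μ-total {m} {s} zero st = sum-zero {xs = gen (length suffix + 0) m s} λ {w} p →
    μ-short τ w (s≤s (≤-reflexive (trans (proj₁ (gen-sound (length suffix + 0) p)) (+-identityʳ _))))
  μ-total {m} {s} (suc e) st = begin
    total (μ τ) (length suffix + suc e) m s
      ≡⟨ cong (λ len → total (μ τ) len m s) (+-suc (length suffix) e) ⟩
    total (μ τ) (suc len) m s
      ≡⟨ total-suc (μ τ) len m s ⟩
    sum (map (λ (m′ , y , t) → total (λ w → μ τ (y ∷ w)) len m′ (y ∷ t)) (steps m s))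
      ≡⟨ sum-cong {xs = steps m s} (λ { {m′ , y , t} p → split p }) ⟩
    sum (map (λ (_ , _ , t) → below (λ i → runs e (suc i)) (length t) + descents e (suc (length t))) (steps m s))
      ≡⟨ sum-steps (λ j → below (λ i → runs e (suc i)) j + descents e (suc j)) m s ⟩
    descents (suc e) (length s) ∎
    where
    open ≡-Reasoning
    len = length suffix + e
    split : ∀ {m′ y t} → (m′ , y , t) ∈ steps m s → total (λ w → μ τ (y ∷ w)) len m′ (y ∷ t) ≡
            below (λ i → runs e (suc i)) (length t) + descents e (suc (length t))
    split {m′} {y} {t} p = begin
      total (λ w → μ τ (y ∷ w)) len m′ (y ∷ t)
        ≡⟨ total-cong len (λ w _ _ → μ-∷ 2 suffix y w) ⟩
      total (λ w → hits y w + μ τ w) len m′ (y ∷ t)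
        ≡⟨ sum-+ (hits y) (μ τ) (gen len m′ (y ∷ t)) ⟩
      total (hits y) len m′ (y ∷ t) + total (μ τ) len m′ (y ∷ t)
        ≡⟨ cong₂ _+_ (hits-total e (steps-stack st p)) (μ-total e (steps-stack st p)) ⟩
      below (λ i → runs e (suc i)) (length t) + descents e (suc (length t)) ∎

corollary5 : (a b n : ℕ) (ρ : List ℕ) → 1 ≤ a → 1 ≤ b →
    IsNC a ρ → (2 ≤ b → StartsWithSingle1 ρ) →
    a + b ∸ 1 ≤ n →
    let τ = map suc ρ ++ replicate b 1
        r = (n + 2) ∸ (a + b)
    in sum (map (μ τ) (NC n)) ≡ (2 * r ∸ 2) C (r + 1)
corollary5 a (suc b) n ρ 1≤a _ nc _ le with nc⇒run nc | canonical-length (proj₁ nc)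
corollary5 a (suc b) n [] () _ nc _ le | _ | refl
-- The empty stack allows only a push, so the first letter is 1 and the remaining run has the form
-- that `Occurrences` takes.
corollary5 a (suc b) n (_ ∷ ρ) _ _ nc _ le | _ , _ , new r | refl = begin
  sum (map (μ τ) (NC n))                      ≡⟨ sum-↭ (map⁺ (μ τ) (NC↭gen n)) ⟩
  total (μ τ) n 0 []                          ≡⟨ cong (λ n → total (μ τ) n 0 []) n≡ ⟨
  total (μ τ) (length suffix + e) 0 []        ≡⟨ μ-total e empty-stack ⟩
  descents e 0                                ≡⟨ descents-total e ⟩
  (e + e) C suc (suc e)                       ≡⟨ cong₂ _C_ double (+-comm 1 (suc e)) ⟩
  (2 * suc e ∸ 2) C (suc e + 1)               ≡⟨ cong (λ r → (2 * r ∸ 2) C (r + 1)) r≡ ⟨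
  (2 * r′ ∸ 2) C (r′ + 1)                     ∎
  where
  open ≡-Reasoning
  open Occurrences ρ b r
  -- Since `a` is `suc (length ρ)`, the subtracted term is `a + b - 1` in the notation of the
  -- theorem, and `e` is `r - 1`.
  e  = n ∸ (length ρ + suc b)
  r′ = (n + 2) ∸ (suc (length ρ) + suc b)
  length-suffix : length suffix ≡ length ρ + suc b
  length-suffix = trans (length-++ (map suc ρ)) (cong₂ _+_ (length-map suc ρ) (length-replicate (suc b)))
  n≡ : length suffix + e ≡ n
  n≡ = trans (cong (_+ e) length-suffix) (m+[n∸m]≡n le)
  double : e + e ≡ 2 * suc e ∸ 2
  double = sym (trans (cong (_∸ 1) (+-suc e (e + 0))) (cong (e +_) (+-identityʳ e)))
  r≡ : r′ ≡ suc e
  r≡ = trans (cong (_∸ (suc (length ρ) + suc b)) (+-comm n 2)) (+-∸-assoc 1 le)
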